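{- Let $D=(E,\mathcal{F})$ be a delta-matroid and let $<$ be any total order on $E$. For $F\in\mathcal{F}$, let $i(F)$ be the number of points of $E$ that are internal, active, and orientable with respect to $F$, and let $j(F)$ be the number of points of $E$ that are external, active, and orientable with respect to $F$. Then the two-variable interlace polynomial $\bar{q}(D;x,y)$ satisfies $$\bar{q}(D;x,y)=\sum_{F\in\mathcal{F}} x^{|F|}\,(1+y/x)^{i(F)}\,(1+xy)^{j(F)} .$$
   Context: A delta-matroid is a pair $D=(E,\mathcal{F})$ where $E$ is a finite set and $\mathcal{F}$ is a nonempty collection of subsets of $E$ (the feasible sets) such that for all $X,Y\in\mathcal{F}$ and $a\in X\Delta Y$ there exists $b\in X\Delta Y$, not necessarily distinct from $a$, with $X\Delta\{a,b\}\in\mathcal{F}$ ($\Delta$ is symmetric difference). For $X\subseteq E$ the twist is $D*X=(E,\{X\Delta F: F\in\mathcal{F}\})$, which is again a delta-matroid. Interlace polynomial: let $r_{\min}(D)$ denote the minimum cardinality of a feasible set of $D$. The two-variable interlace polynomial of $D$ is $\bar{q}(D;x,y)=\sum_{A\subseteq E} x^{|A|}y^{r_{\min}(D*A)}$, with $x,y$ indeterminates. Activities: fix $F\in\mathcal{F}$. A point $a\in E$ is $F$-nonorientable if $\{a\}$ is feasible in $D*F$, and $F$-orientable (orientable with respect to $F$) otherwise. A pair $\{a,b\}\subseteq E$, $a\neq b$, is $F$-paired if $\{a,b\}$ is feasible in $D*F$, and $F$-separated otherwise. Distinct points $a,b$ are $F$-interlaced if either (1) at most one of $a,b$ is $F$-nonorientable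 and $\{a,b\}$ is $F$-paired, or (2) both $a$ and $b$ are $F$-nonorientable and $\{a,b\}$ is $F$-separated. Given a total order $<$ on $E$, a point $a$ is active with respect to $F$ if $a$ is not $F$-interlaced with any lower-ordered point. A point $a$ is internal (with respect to $F$) if $a\in F$ and external otherwise. -}

module Defs where

open import Level using (Level; 0ℓ; suc; _⊔_)
open import Algebra.Bundles.Raw using (RawSemiring)
import Algebra.Definitions.RawSemiring as RawSemiringDefinitions
open import Data.Bool.Base using (true; false; if_then_else_; _∧_; _xor_)
import Data.Bool.Properties as Bool
open import Data.Fin.Base using (Fin)
import Data.Fin.Properties as Fin
open import Data.Fin.Subset using (Subset; ⁅_⁆; _∪_; _∈_; ∣_∣; inside; outside)
open import Data.Fin.Subset.Properties using (_∈?_; anySubset?)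
open import Data.Integer.Base as ℤ using (ℤ; 0ℤ; 1ℤ; -1ℤ)
import Data.Integer.Properties as ℤ
open import Data.List.Base
  using (List; []; _∷_; _++_; map; filter; foldr; length; allFin; cartesianProductWith)
open import Data.List.Extrema.Nat using (min)
open import Data.Nat.Base using (ℕ)
open import Data.Product.Base using (∃; _×_; _,_)
open import Data.Sum.Base using (_⊎_)
open import Data.Vec.Base using ([]; _∷_; zipWith)
import Data.Vec.Properties as Vec
open import Relation.Binary.Core using (Rel)
open import Relation.Binary.Definitions using (DecidableEquality)
open import Relation.Binary.Structures using (IsStrictTotalOrder)
open import Relation.Binary.PropositionalEquality
  using (_≡_; _≢_; refl; sym; cong; subst)
open import Relation.Nullary using (Dec; ¬_; does; ¬?; _×-dec_; _⊎-dec_; _→-dec_)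
open import Relation.Unary using (Pred; Decidable)

private
  variable
    ℓ ℓ′ : Level
    n : ℕ

------------------------------------------------------------------------
-- Subsets of a finite set

infixl 6 _∆_

_∆_ : Subset n → Subset n → Subset n
_∆_ = zipWith _xor_

∆-assoc : (X Y Z : Subset n) → (X ∆ Y) ∆ Z ≡ X ∆ (Y ∆ Z)
∆-assoc = Vec.zipWith-assoc Bool.xor-assoc

∆-cancel : (A X Y : Subset n) → (A ∆ X) ∆ (A ∆ Y) ≡ X ∆ Y
∆-cancel []          []      []      = refl
∆-cancel (true  ∷ A) (x ∷ X) (y ∷ Y) rewrite ∆-cancel A X Y = cong (_∷ (X ∆ Y)) (not-xor-not x y)
  where
  not-xor-not : ∀ x y → (true xor x) xor (true xor y) ≡ x xor y
  not-xor-not false false = refl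
  not-xor-not false true  = refl
  not-xor-not true  false = refl
  not-xor-not true  true  = refl
∆-cancel (false ∷ A) (x ∷ X) (y ∷ Y) = cong ((x xor y) ∷_) (∆-cancel A X Y)

_≟ˢ_ : DecidableEquality (Subset n)
_≟ˢ_ = Vec.≡-dec Bool._≟_

-- Every subset of Fin n occurs exactly once.
subsets : (n : ℕ) → List (Subset n)
subsets ℕ.zero    = [] ∷ []
subsets (ℕ.suc n) = map (outside ∷_) (subsets n) ++ map (inside ∷_) (subsets n)

------------------------------------------------------------------------
-- Delta-matroids on the ground set Fin n

-- The collection of feasible sets is a decidable predicate, so that it can
-- be enumerated and summed over.
record DeltaMatroid (ℓ : Level) (n : ℕ) : Set (suc ℓ) where
  field
    Feasible  : Pred (Subset n) ℓ
    feasible? : Decidable Feasible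
    nonempty  : ∃ Feasible
    exchange  : ∀ {X Y} → Feasible X → Feasible Y → ∀ {a} → a ∈ X ∆ Y →
                ∃ λ b → b ∈ X ∆ Y × Feasible (X ∆ (⁅ a ⁆ ∪ ⁅ b ⁆))

open DeltaMatroid public

twist : DeltaMatroid ℓ n → Subset n → DeltaMatroid ℓ n
twist D A .Feasible S  = ∃ λ F → Feasible D F × S ≡ A ∆ F
twist D A .feasible? S = anySubset? λ F → feasible? D F ×-dec (S ≟ˢ (A ∆ F))
twist D A .nonempty    = let (F , F∈D) = nonempty D in A ∆ F , F , F∈D , refl
twist D A .exchange (F , F∈D , refl) (G , G∈D , refl) {a} a∈
  with exchange D F∈D G∈D (subst (a ∈_) (∆-cancel A F G) a∈)
... | b , b∈ , F∆ab∈D =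
  b , subst (b ∈_) (sym (∆-cancel A F G)) b∈ , _ , F∆ab∈D , ∆-assoc A F _

feasibleSets : DeltaMatroid ℓ n → List (Subset n)
feasibleSets {n = n} D = filter (feasible? D) (subsets n)

-- The first argument of min is a default for the empty list.  It does not
-- affect the result, since there is a feasible set and its size is at most n.
r-min : DeltaMatroid ℓ n → ℕ
r-min {n = n} D = min n (map ∣_∣ (feasibleSets D))

------------------------------------------------------------------------
-- Orientability, interlacement and activity with respect to F

module _ (D : DeltaMatroid ℓ n) (F : Subset n) where

  Nonorientable : Pred (Fin n) ℓ
  Nonorientable a = Feasible (twist D F) ⁅ a ⁆

  Orientable : Pred (Fin n) ℓ
  Orientable a = ¬ Nonorientable a

  Paired : Rel (Fin n) ℓ
  Paired a b = Feasible (twist D F) (⁅ a ⁆ ∪ ⁅ b ⁆)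

  Separated : Rel (Fin n) ℓ
  Separated a b = ¬ Paired a b

  Interlaced : Rel (Fin n) ℓ
  Interlaced a b = a ≢ b ×
    ( (¬ (Nonorientable a × Nonorientable b) × Paired a b)
    ⊎ ((Nonorientable a × Nonorientable b) × Separated a b))

  nonorientable? : Decidable Nonorientable
  nonorientable? a = feasible? (twist D F) ⁅ a ⁆

  orientable? : Decidable Orientable
  orientable? a = ¬? (nonorientable? a)

  interlaced? : ∀ a b → Dec (Interlaced a b)
  interlaced? a b = ¬? (a Fin.≟ b) ×-dec
    ((¬? both? ×-dec paired?) ⊎-dec (both? ×-dec ¬? paired?))
    where
    both?   = nonorientable? a ×-dec nonorientable? b
    paired? = feasible? (twist D F) (⁅ a ⁆ ∪ ⁅ b ⁆)

  module _ {_<_ : Rel (Fin n) ℓ′} (isSTO : IsStrictTotalOrder _≡_ _<_) where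

    open IsStrictTotalOrder isSTO using (_<?_)

    Active : Pred (Fin n) (ℓ ⊔ ℓ′)
    Active a = ∀ b → b < a → ¬ Interlaced a b

    active? : Decidable Active
    active? a = Fin.all? λ b → (b <? a) →-dec ¬? (interlaced? a b)

    internalActiveOrientable : ℕ
    internalActiveOrientable = length
      (filter (λ a → (a ∈? F) ×-dec active? a ×-dec orientable? a) (allFin n))

    externalActiveOrientable : ℕ
    externalActiveOrientable = length
      (filter (λ a → ¬? (a ∈? F) ×-dec active? a ×-dec orientable? a) (allFin n))

------------------------------------------------------------------------
-- The ring ℤ[x,x⁻¹,y,y⁻¹] of Laurent polynomials in two indeterminates

record Term : Set where
  constructor term
  field
    coefficient degˣ degʸ : ℤ

open Term public

-- A list of terms denotes their sum; exponents may repeat and coefficients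
-- may vanish, so equality is equality of all collected coefficients.
Laurent : Set
Laurent = List Term

coeff : Laurent → ℤ → ℤ → ℤ
coeff []      i j = 0ℤ
coeff (t ∷ p) i j =
  (if does (degˣ t ℤ.≟ i) ∧ does (degʸ t ℤ.≟ j) then coefficient t else 0ℤ)
  ℤ.+ coeff p i j

infix 4 _≈_

_≈_ : Rel Laurent 0ℓ
p ≈ q = ∀ i j → coeff p i j ≡ coeff q i j

_*ᵗ_ : Term → Term → Term
term c i j *ᵗ term d k l = term (c ℤ.* d) (i ℤ.+ k) (j ℤ.+ l)

laurentRawSemiring : RawSemiring 0ℓ 0ℓ
laurentRawSemiring = record
  { Carrier = Laurent
  ; _≈_     = _≈_
  ; _+_     = _++_
  ; _*_     = cartesianProductWith _*ᵗ_
  ; 0#      = []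
  ; 1#      = term 1ℤ 0ℤ 0ℤ ∷ []
  }

open RawSemiring laurentRawSemiring public using (_+_; _*_; 0#; 1#)
open RawSemiringDefinitions laurentRawSemiring public using (_^_)

x x⁻¹ y : Laurent
x   = term 1ℤ 1ℤ  0ℤ ∷ []
x⁻¹ = term 1ℤ -1ℤ 0ℤ ∷ []
y   = term 1ℤ 0ℤ  1ℤ ∷ []

∑ : ∀ {a} {A : Set a} → List A → (A → Laurent) → Laurent
∑ as f = foldr _+_ 0# (map f as)

syntax ∑ as (λ a → p) = ∑[ a ← as ] p

------------------------------------------------------------------------
-- The two-variable interlace polynomial

interlacePolynomial : DeltaMatroid ℓ n → Laurent
interlacePolynomial {n = n} D = ∑[ A ← subsets n ] (x ^ ∣ A ∣ * y ^ r-min (twist D A))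

{-# OPTIONS --safe #-}

-- Let T F be the set of active orientable points of F.  Expanding the powers
-- turns the summand of F into the sum of x^|A| y^|A ∆ F| over the A with
-- A ∆ F ⊆ T F, so it suffices that every A has a unique feasible F with
-- A ∆ F ⊆ T F, and that this F is a feasible set nearest to A.
--
-- A point e lies in T F exactly when no F ∆ {e, b} with b ≤ e is feasible.
-- Uniqueness: if F and F′ both fit A and e ∈ F ∆ F′, then e lies in A ∆ F or
-- in A ∆ F′, so exchange at e yields a larger element of F ∆ F′.
-- Existence: if e ∈ A ∆ F is not in T F, then passing to F ∆ {e, b} does not
-- increase the distance to A and decreases the sum of the ranks of the
-- elements of A ∆ F.
module Submission where

open import Defs
open import Level using (Level)
open import Algebra.Bundles using (CommutativeSemiring)
open import Algebra.Structures using (IsCommutativeMonoid)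
open import Algebra.Structures.Biased using (isCommutativeSemiringˡ)
import Algebra.Properties.CommutativeSemigroup as CommutativeSemigroupProperties
open import Data.Bool.Base using (Bool; true; false; if_then_else_; _∧_)
import Data.Bool.Properties as Bool
open import Data.Nat.Base as ℕ using (ℕ; zero; suc)
import Data.Nat.Properties as ℕ
import Data.Nat.Induction as ℕ
open import Data.Fin.Base using (Fin; zero; suc)
import Data.Fin.Properties as Fin
open import Data.Fin.Induction using (spo-noetherian)
open import Data.Fin.Subset
  using (Subset; ⊥; inside; outside; ⁅_⁆; _∪_; _∩_; ∁; _∈_; _∉_; _⊆_; ∣_∣)
open import Data.Fin.Subset.Properties
  using (_∈?_; _⊆?_; ∪-idem; ∪-identityˡ; ∪-identityʳ; p⊂q⇒∣p∣<∣q∣; ∣p∣≤n;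
         x∈p∩q⁺; x∈p∩q⁻; x∉p⇒x∈∁p; x∈∁p⇒x∉p; x∈⁅x⁆; drop-there)
import Data.Integer.Properties as ℤ
import Data.Integer.Base as ℤ
open import Data.List.Base as List
  using (List; []; _∷_; _++_; map; filter; length)
import Data.List.Properties as List
open import Data.List.Extrema.Nat using (min≈v⁺)
import Data.List.Membership.Propositional as List
open import Data.List.Membership.Propositional.Properties
  using (∈-map⁺; ∈-map⁻; ∈-++⁺ˡ; ∈-++⁺ʳ; ∈-filter⁺; ∈-filter⁻)
import Data.List.Relation.Unary.All as All
open import Data.List.Relation.Unary.Any using (here)
open import Data.List.Relation.Binary.Permutation.Propositional
  using (_↭_; ↭-refl; ↭-sym; ↭-trans; ↭-reflexive; refl; prep; swap; trans;
         module PermutationReasoning)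
open import Data.List.Relation.Binary.Permutation.Propositional.Properties
  using (++⁺ˡ; shifts; ++-isCommutativeMonoid)
open import Data.Product.Base as Product using (∃; _×_; _,_; proj₁; proj₂)
open import Data.Sum.Base as Sum using (_⊎_; inj₁; inj₂)
open import Data.Vec.Base using ([]; _∷_; here; there; tabulate)
import Data.Vec.Properties as Vec
open import Function.Base using (_∘_; flip; const)
open import Function.Bundles using (_⇔_; mk⇔; Equivalence)
open import Induction.WellFounded using (Acc; acc)
open import Relation.Binary.Core using (Rel)
open import Relation.Binary.Definitions using (tri<; tri≈; tri>)
open import Relation.Binary.Structures using (IsStrictTotalOrder)
open import Relation.Binary.PropositionalEquality as ≡
  using (_≡_; _≢_; refl; sym; cong; cong₂; subst)
open import Relation.Nullary
open import Relation.Nullary.Decidable using (decidable-stable; dec-true; dec-false)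
open import Relation.Unary using (Pred; Decidable)

private
  variable
    ℓ ℓ′ : Level
    A B : Set ℓ
    n : ℕ

-- Laurent polynomials as multisets of terms

-- No cancellation occurs in the theorem, so it already holds for the
-- multisets of terms, which form a commutative semiring under _↭_.

monomialCoeff : Term → ℤ.ℤ → ℤ.ℤ → ℤ.ℤ
monomialCoeff t i j =
  if does (degˣ t ℤ.≟ i) ∧ does (degʸ t ℤ.≟ j) then coefficient t else ℤ.0ℤ

-- A collected coefficient is a sum of integers, so the order of the terms is immaterial. This is
-- the only passage from `↭` to `≈`, made once at the end.
↭⇒≈ : ∀ {p q} → p ↭ q → p ≈ q
↭⇒≈ refl             i j = refl
↭⇒≈ (prep t p↭q)     i j = cong (λ c → monomialCoeff t i j ℤ.+ c) (↭⇒≈ p↭q i j)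
↭⇒≈ (swap {ys = q} s t p↭q) i j = ≡.trans
  (cong (λ c → monomialCoeff s i j ℤ.+ (monomialCoeff t i j ℤ.+ c)) (↭⇒≈ p↭q i j))
  (x∙yz≈y∙xz (monomialCoeff s i j) (monomialCoeff t i j) (coeff q i j))
  where open CommutativeSemigroupProperties ℤ.+-commutativeSemigroup
↭⇒≈ (trans p↭q q↭r)  i j = ≡.trans (↭⇒≈ p↭q i j) (↭⇒≈ q↭r i j)

*ᵗ-assoc : ∀ s t u → (s *ᵗ t) *ᵗ u ≡ s *ᵗ (t *ᵗ u)
*ᵗ-assoc (term c i k) (term c′ i′ k′) (term c″ i″ k″)
  rewrite ℤ.*-assoc c c′ c″ | ℤ.+-assoc i i′ i″ | ℤ.+-assoc k k′ k″ = refl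

*ᵗ-comm : ∀ s t → s *ᵗ t ≡ t *ᵗ s
*ᵗ-comm (term c i k) (term c′ i′ k′)
  rewrite ℤ.*-comm c c′ | ℤ.+-comm i i′ | ℤ.+-comm k k′ = refl

*ᵗ-identityˡ : ∀ t → term ℤ.1ℤ ℤ.0ℤ ℤ.0ℤ *ᵗ t ≡ t
*ᵗ-identityˡ (term c i k)
  rewrite ℤ.*-identityˡ c | ℤ.+-identityˡ i | ℤ.+-identityˡ k = refl

map-*ᵗ-* : ∀ t p q → map (t *ᵗ_) p * q ≡ map (t *ᵗ_) (p * q)
map-*ᵗ-* t []      q = refl
map-*ᵗ-* t (s ∷ p) q = begin
  map ((t *ᵗ s) *ᵗ_) q ++ map (t *ᵗ_) p * q
    ≡⟨ cong₂ _++_ (List.map-cong (*ᵗ-assoc t s) q) (map-*ᵗ-* t p q) ⟩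
  map (λ u → t *ᵗ (s *ᵗ u)) q ++ map (t *ᵗ_) (p * q)
    ≡⟨ cong (_++ _) (List.map-∘ q) ⟩
  map (t *ᵗ_) (map (s *ᵗ_) q) ++ map (t *ᵗ_) (p * q)
    ≡⟨ List.map-++ (t *ᵗ_) (map (s *ᵗ_) q) (p * q) ⟨
  map (t *ᵗ_) (map (s *ᵗ_) q ++ p * q) ∎
  where open ≡.≡-Reasoning

*-distribʳ : ∀ r p q → (p + q) * r ≡ p * r + q * r
*-distribʳ r p q = List.cartesianProductWith-distribʳ-++ _*ᵗ_ p q r

*-assoc-↭ : ∀ p q r → (p * q) * r ↭ p * (q * r)
*-assoc-↭ []      q r = ↭-refl
*-assoc-↭ (t ∷ p) q r = begin
  (map (t *ᵗ_) q ++ p * q) * r     ≡⟨ *-distribʳ r (map (t *ᵗ_) q) (p * q) ⟩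
  map (t *ᵗ_) q * r ++ p * q * r   ≡⟨ cong (_++ _) (map-*ᵗ-* t q r) ⟩
  map (t *ᵗ_) (q * r) ++ p * q * r ↭⟨ ++⁺ˡ _ (*-assoc-↭ p q r) ⟩
  map (t *ᵗ_) (q * r) ++ p * (q * r) ∎
  where open PermutationReasoning

-- The product recurses on its left factor; this is the matching recursion on the right factor,
-- which commutativity needs. The terms come out in another order, hence `↭`.
*-∷ : ∀ t p q → p * (t ∷ q) ↭ map (t *ᵗ_) p ++ p * q
*-∷ t []      q = ↭-refl
*-∷ t (s ∷ p) q = begin
  s *ᵗ t ∷ map (s *ᵗ_) q ++ p * (t ∷ q)
    ≡⟨ cong (_∷ map (s *ᵗ_) q ++ p * (t ∷ q)) (*ᵗ-comm s t) ⟩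
  t *ᵗ s ∷ map (s *ᵗ_) q ++ p * (t ∷ q)
    ↭⟨ prep _ (++⁺ˡ (map (s *ᵗ_) q) (*-∷ t p q)) ⟩
  t *ᵗ s ∷ map (s *ᵗ_) q ++ map (t *ᵗ_) p ++ p * q
    ↭⟨ prep _ (shifts (map (s *ᵗ_) q) (map (t *ᵗ_) p)) ⟩
  t *ᵗ s ∷ map (t *ᵗ_) p ++ map (s *ᵗ_) q ++ p * q ∎
  where open PermutationReasoning

*-comm-↭ : ∀ p q → p * q ↭ q * p
*-comm-↭ []      q = ↭-reflexive (sym (List.cartesianProductWith-zeroʳ _*ᵗ_ q))
*-comm-↭ (t ∷ p) q =
  ↭-trans (++⁺ˡ (map (t *ᵗ_) q) (*-comm-↭ p q)) (↭-sym (*-∷ t q p))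

*-congʳ-↭ : ∀ r {p q} → p ↭ q → p * r ↭ q * r
*-congʳ-↭ r refl            = refl
*-congʳ-↭ r (prep t p↭q)    = ++⁺ˡ (map (t *ᵗ_) r) (*-congʳ-↭ r p↭q)
*-congʳ-↭ r (swap s t p↭q)  = ↭-trans
  (shifts (map (s *ᵗ_) r) (map (t *ᵗ_) r))
  (++⁺ˡ (map (t *ᵗ_) r) (++⁺ˡ (map (s *ᵗ_) r) (*-congʳ-↭ r p↭q)))
*-congʳ-↭ r (trans p↭q q↭s) = trans (*-congʳ-↭ r p↭q) (*-congʳ-↭ r q↭s)

*-cong-↭ : ∀ {p q r s} → p ↭ q → r ↭ s → p * r ↭ q * s
*-cong-↭ {p} {q} {r} {s} p↭q r↭s = begin
  p * r ↭⟨ *-congʳ-↭ r p↭q ⟩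
  q * r ↭⟨ *-comm-↭ q r ⟩
  r * q ↭⟨ *-congʳ-↭ q r↭s ⟩
  s * q ↭⟨ *-comm-↭ s q ⟩
  q * s ∎
  where open PermutationReasoning

*-identityˡ-↭ : ∀ p → 1# * p ↭ p
*-identityˡ-↭ p = ↭-reflexive (begin
  map (term ℤ.1ℤ ℤ.0ℤ ℤ.0ℤ *ᵗ_) p ++ [] ≡⟨ List.++-identityʳ _ ⟩
  map (term ℤ.1ℤ ℤ.0ℤ ℤ.0ℤ *ᵗ_) p       ≡⟨ List.map-cong *ᵗ-identityˡ p ⟩
  map (λ t → t) p                       ≡⟨ List.map-id p ⟩
  p                                     ∎)
  where open ≡.≡-Reasoning

*-1-isCommutativeMonoid : IsCommutativeMonoid _↭_ _*_ 1#
*-1-isCommutativeMonoid = record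
  { isMonoid = record
    { isSemigroup = record
      { isMagma = record
        { isEquivalence = IsCommutativeMonoid.isEquivalence (++-isCommutativeMonoid {A = Term})
        ; ∙-cong        = *-cong-↭
        }
      ; assoc = *-assoc-↭
      }
    ; identity = *-identityˡ-↭ , λ p → ↭-trans (*-comm-↭ p 1#) (*-identityˡ-↭ p)
    }
  ; comm = *-comm-↭
  }

termMultisets : CommutativeSemiring _ _
termMultisets = record
  { isCommutativeSemiring = isCommutativeSemiringˡ (record
    { +-isCommutativeMonoid = ++-isCommutativeMonoid
    ; *-isCommutativeMonoid = *-1-isCommutativeMonoid
    ; distribʳ              = λ r p q → ↭-reflexive (*-distribʳ r p q)
    ; zeroˡ                 = λ p → ↭-refl
    })
  }

open CommutativeSemiring termMultisets using
  ( +-cong; +-congˡ; +-identityʳ; +-comm; +-commutativeSemigroup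
  ; *-cong; *-congˡ; *-congʳ; *-assoc; *-identityˡ; *-commutativeSemigroup
  ; distribˡ; distribʳ; zeroʳ )

-- Sums

∑-cong : ∀ {f g : A → Laurent} as → (∀ a → f a ↭ g a) → ∑ as f ↭ ∑ as g
∑-cong []       f↭g = ↭-refl
∑-cong (a ∷ as) f↭g = +-cong (f↭g a) (∑-cong as f↭g)

∑-zero : ∀ {f : A → Laurent} as → (∀ a → f a ≡ 0#) → ∑ as f ≡ 0#
∑-zero []       f≡0 = refl
∑-zero (a ∷ as) f≡0 rewrite f≡0 a = ∑-zero as f≡0

∑-++ : ∀ as bs (f : A → Laurent) → ∑ (as ++ bs) f ≡ ∑ as f + ∑ bs f
∑-++ []       bs f = refl
∑-++ (a ∷ as) bs f =
  ≡.trans (cong (f a +_) (∑-++ as bs f)) (sym (List.++-assoc (f a) _ _))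

∑-map : ∀ (g : B → A) bs (f : A → Laurent) → ∑ (map g bs) f ≡ ∑ bs (f ∘ g)
∑-map g bs f = cong (List.foldr _+_ 0#) (sym (List.map-∘ bs))

∑-+ : ∀ as (f g : A → Laurent) → ∑ as (λ a → f a + g a) ↭ ∑ as f + ∑ as g
∑-+ []       f g = ↭-refl
∑-+ (a ∷ as) f g = ↭-trans (+-congˡ {f a + g a} (∑-+ as f g)) (interchange (f a) (g a) _ _)
  where open CommutativeSemigroupProperties +-commutativeSemigroup

*-∑ : ∀ p as (f : A → Laurent) → ∑ as (λ a → p * f a) ↭ p * ∑ as f
*-∑ p []       f = ↭-sym (zeroʳ p)
*-∑ p (a ∷ as) f = ↭-trans (+-congˡ {p * f a} (*-∑ p as f)) (↭-sym (distribˡ p (f a) _))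

∑-swap : ∀ (as : List A) (bs : List B) (f : A → B → Laurent) →
         ∑[ a ← as ] ∑[ b ← bs ] f a b ↭ ∑[ b ← bs ] ∑[ a ← as ] f a b
∑-swap []       bs f = ↭-reflexive (sym (∑-zero bs λ _ → refl))
∑-swap (a ∷ as) bs f = ↭-trans
  (+-congˡ {∑ bs (f a)} (∑-swap as bs f)) (↭-sym (∑-+ bs (f a) _))

∑-filter : ∀ {P : Pred A ℓ} (P? : Decidable P) as (f : A → Laurent) →
           ∑ (filter P? as) f ≡ ∑[ a ← as ] (if does (P? a) then f a else 0#)
∑-filter P? []       f = refl
∑-filter P? (a ∷ as) f with does (P? a)
... | false = ∑-filter P? as f
... | true  = cong (f a +_) (∑-filter P? as f)

∑-subsets : ∀ (f : Subset (suc n) → Laurent) →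
  ∑ (subsets (suc n)) f ≡
  ∑ (subsets n) (f ∘ (outside ∷_)) + ∑ (subsets n) (f ∘ (inside ∷_))
∑-subsets {n} f = ≡.trans
  (∑-++ (map (outside ∷_) (subsets n)) _ f)
  (cong₂ _+_ (∑-map _ (subsets n) f) (∑-map _ (subsets n) f))

-- Induction on `F`: its head tells which half of `subsets (suc n)` contains only sets different
-- from `F`, and that half vanishes.
∑-single : ∀ (f : Subset n → Laurent) F → (∀ G → G ≢ F → f G ≡ 0#) →
           ∑ (subsets n) f ↭ f F
∑-single {zero}  f []            f≡0 = +-identityʳ (f [])
∑-single {suc n} f (outside ∷ F) f≡0 = begin
  ∑ (subsets (suc n)) f
    ≡⟨ ∑-subsets f ⟩
  ∑ (subsets n) (f ∘ (outside ∷_)) + ∑ (subsets n) (f ∘ (inside ∷_))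
    ≡⟨ cong (∑ (subsets n) (f ∘ (outside ∷_)) +_) (∑-zero (subsets n) λ G → f≡0 (inside ∷ G) λ ()) ⟩
  ∑ (subsets n) (f ∘ (outside ∷_)) + 0#
    ↭⟨ +-identityʳ _ ⟩
  ∑ (subsets n) (f ∘ (outside ∷_))
    ↭⟨ ∑-single (f ∘ (outside ∷_)) F (λ G G≢F → f≡0 (outside ∷ G) (G≢F ∘ Vec.∷-injectiveʳ)) ⟩
  f (outside ∷ F) ∎
  where open PermutationReasoning
∑-single {suc n} f (inside ∷ F) f≡0 = begin
  ∑ (subsets (suc n)) f
    ≡⟨ ∑-subsets f ⟩
  ∑ (subsets n) (f ∘ (outside ∷_)) + ∑ (subsets n) (f ∘ (inside ∷_))
    ≡⟨ cong (_+ ∑ (subsets n) (f ∘ (inside ∷_))) (∑-zero (subsets n) λ G → f≡0 (outside ∷ G) λ ()) ⟩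
  ∑ (subsets n) (f ∘ (inside ∷_))
    ↭⟨ ∑-single (f ∘ (inside ∷_)) F (λ G G≢F → f≡0 (inside ∷ G) (G≢F ∘ Vec.∷-injectiveʳ)) ⟩
  f (inside ∷ F) ∎
  where open PermutationReasoning

-- The interval of A with A ∆ F ⊆ T

if-* : ∀ (b : Bool) p q → (if b then p * q else 0#) ↭ p * (if b then q else 0#)
if-* true  p q = ↭-refl
if-* false p q = ↭-sym (zeroʳ p)

-- The summand of `A` in the interlace polynomial, provided that `F` is a feasible set nearest to
-- `A`.
distance-monomial : Subset n → Subset n → Laurent
distance-monomial F A = x ^ ∣ A ∣ * y ^ ∣ A ∆ F ∣

-- Only the heads of the vectors change here, so the indicator of A ∆ F ⊆ T
-- stays the same and can be any family of Booleans.
∑-if-* : ∀ {n} p (c : Subset n → Bool) (f g : Subset n → Laurent) → (∀ A → f A ↭ p * g A) →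
         ∑[ A ← subsets n ] (if c A then f A else 0#) ↭
         p * (∑[ A ← subsets n ] (if c A then g A else 0#))
∑-if-* {n} p c f g f↭pg = ↭-trans
  (∑-cong (subsets n) λ A → ↭-trans (if-cong (c A) A) (if-* (c A) p (g A)))
  (*-∑ p (subsets n) _)
  where
  if-cong : ∀ b A → (if b then f A else 0#) ↭ (if b then p * g A else 0#)
  if-cong true  A = f↭pg A
  if-cong false A = ↭-refl

-- The sum factors over the points. Outside `T` the set `A` must agree with `F`, which gives 1 or
-- `x`. In `T` both choices are open: an external point gives `1# + x * y`, an internal one `y + x`,
-- that is, `x * (1# + y * x⁻¹)`.
∑-interval : ∀ (F T : Subset n) →
  ∑[ A ← subsets n ] (if does ((A ∆ F) ⊆? T) then distance-monomial F A else 0#) ↭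
  x ^ ∣ F ∣ * (1# + y * x⁻¹) ^ ∣ F ∩ T ∣ * (1# + x * y) ^ ∣ ∁ F ∩ T ∣
∑-interval [] [] = ↭-refl
∑-interval {suc n} (f ∷ F) (t ∷ T) =
  ↭-trans (↭-reflexive (∑-subsets {n} _)) (step f t)
  where
  open CommutativeSemigroupProperties *-commutativeSemigroup
  c : Subset n → Bool
  c A = does ((A ∆ F) ⊆? T)
  X I J S : Laurent
  X = x ^ ∣ F ∣
  I = (1# + y * x⁻¹) ^ ∣ F ∩ T ∣
  J = (1# + x * y) ^ ∣ ∁ F ∩ T ∣
  S = ∑[ A ← subsets n ] (if c A then distance-monomial F A else 0#)

  IH : S ↭ X * I * J
  IH = ∑-interval F T

  open PermutationReasoning

  step : ∀ f t →
    ∑[ A ← subsets n ] (if does (((outside ∷ A) ∆ (f ∷ F)) ⊆? (t ∷ T))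
                        then distance-monomial (f ∷ F) (outside ∷ A) else 0#) +
    ∑[ A ← subsets n ] (if does (((inside ∷ A) ∆ (f ∷ F)) ⊆? (t ∷ T))
                        then distance-monomial (f ∷ F) (inside ∷ A) else 0#) ↭
    x ^ ∣ f ∷ F ∣ * (1# + y * x⁻¹) ^ ∣ (f ∷ F) ∩ (t ∷ T) ∣
                  * (1# + x * y) ^ ∣ ∁ (f ∷ F) ∩ (t ∷ T) ∣
  step outside outside = begin
    S + _  ≡⟨ cong (S +_) (∑-zero (subsets n) λ _ → refl) ⟩
    S + 0# ↭⟨ +-identityʳ S ⟩
    S      ↭⟨ IH ⟩
    X * I * J ∎
  step outside inside = begin
    S + _
      -- Adding an external point to `A` enlarges both `A` and `A ∆ F`, whence the factor `x * y`.
      ↭⟨ +-cong (*-identityˡ S) (↭-sym (∑-if-* (x * y) c _ (distance-monomial F)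
           (λ A → interchange x (x ^ ∣ A ∣) y _))) ⟨
    1# * S + (x * y) * S
      ↭⟨ distribʳ S 1# (x * y) ⟨
    (1# + x * y) * S
      ↭⟨ *-congˡ {1# + x * y} IH ⟩
    (1# + x * y) * (X * I * J)
      ↭⟨ x∙yz≈y∙xz (1# + x * y) (X * I) J ⟩
    X * I * ((1# + x * y) * J) ∎
  step inside outside = begin
    _ + ∑[ A ← subsets n ] (if c A then x * x ^ ∣ A ∣ * y ^ ∣ A ∆ F ∣ else 0#)
      ≡⟨ cong (_+ ∑[ A ← subsets n ] (if c A then x * x ^ ∣ A ∣ * y ^ ∣ A ∆ F ∣ else 0#))
           (∑-zero (subsets n) λ _ → refl) ⟩
    ∑[ A ← subsets n ] (if c A then x * x ^ ∣ A ∣ * y ^ ∣ A ∆ F ∣ else 0#)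
      ↭⟨ ∑-if-* x c _ (distance-monomial F) (λ A → *-assoc x (x ^ ∣ A ∣) _) ⟩
    x * S
      ↭⟨ *-congˡ {x} IH ⟩
    x * (X * I * J)
      ↭⟨ *-assoc x (X * I) J ⟨
    x * (X * I) * J
      ↭⟨ *-congʳ {J} (*-assoc x X I) ⟨
    x * X * I * J ∎
  step inside inside = begin
    ∑[ A ← subsets n ] (if c A then x ^ ∣ A ∣ * (y * y ^ ∣ A ∆ F ∣) else 0#) +
    ∑[ A ← subsets n ] (if c A then x * x ^ ∣ A ∣ * y ^ ∣ A ∆ F ∣ else 0#)
      ↭⟨ +-cong (∑-if-* y c _ (distance-monomial F) (λ A → x∙yz≈y∙xz (x ^ ∣ A ∣) y _))
                (∑-if-* x c _ (distance-monomial F) (λ A → *-assoc x (x ^ ∣ A ∣) _)) ⟩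
    y * S + x * S
      ↭⟨ distribʳ S y x ⟨
    (y + x) * S
      -- `x + y` and `x * (1# + y * x⁻¹)` evaluate to the same list of terms, so the cancellation of
      -- `x⁻¹` is a computation.
      ↭⟨ *-cong (+-comm y x) IH ⟩
    (x * (1# + y * x⁻¹)) * (X * I * J)
      ↭⟨ *-assoc (x * (1# + y * x⁻¹)) (X * I) J ⟨
    (x * (1# + y * x⁻¹)) * (X * I) * J
      ↭⟨ *-congʳ {J} (interchange x (1# + y * x⁻¹) X I) ⟩
    x * X * ((1# + y * x⁻¹) * I) * J ∎

-- Subsets and weights

∈-subsets : ∀ (F : Subset n) → F List.∈ subsets n
∈-subsets []            = here refl
∈-subsets (outside ∷ F) = ∈-++⁺ˡ (∈-map⁺ _ (∈-subsets F))
∈-subsets (inside  ∷ F) = ∈-++⁺ʳ (map (outside ∷_) (subsets _)) (∈-map⁺ _ (∈-subsets F))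

∆-comm : ∀ (X Y : Subset n) → X ∆ Y ≡ Y ∆ X
∆-comm = Vec.zipWith-comm Bool.xor-comm

∆-cancelˡ : ∀ (X Y : Subset n) → X ∆ (X ∆ Y) ≡ Y
∆-cancelˡ []            []      = refl
∆-cancelˡ (inside  ∷ X) (s ∷ Y) = cong₂ _∷_ (Bool.not-involutive s) (∆-cancelˡ X Y)
∆-cancelˡ (outside ∷ X) (s ∷ Y) = cong (s ∷_) (∆-cancelˡ X Y)

∈-∆⁻ : ∀ {e} (X Y : Subset n) → e ∈ X ∆ Y → e ∈ X ⊎ e ∈ Y
∈-∆⁻ (inside  ∷ X) (outside ∷ Y) here       = inj₁ here
∈-∆⁻ (outside ∷ X) (inside  ∷ Y) here       = inj₂ here
∈-∆⁻ (_       ∷ X) (_       ∷ Y) (there e∈) = Sum.map there there (∈-∆⁻ X Y e∈)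

empty-∆⇒≡ : ∀ (X Y : Subset n) → (∀ e → e ∉ X ∆ Y) → X ≡ Y
empty-∆⇒≡ []            []            ∉ = refl
empty-∆⇒≡ (inside  ∷ X) (inside  ∷ Y) ∉ = cong (inside ∷_)  (empty-∆⇒≡ X Y λ e → ∉ (suc e) ∘ there)
empty-∆⇒≡ (inside  ∷ X) (outside ∷ Y) ∉ = contradiction here (∉ zero)
empty-∆⇒≡ (outside ∷ X) (inside  ∷ Y) ∉ = contradiction here (∉ zero)
empty-∆⇒≡ (outside ∷ X) (outside ∷ Y) ∉ = cong (outside ∷_) (empty-∆⇒≡ X Y λ e → ∉ (suc e) ∘ there)

∆-⊥ : ∀ (X : Subset n) → X ∆ ⊥ ≡ X
∆-⊥ = Vec.zipWith-identityʳ Bool.xor-identityʳ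

⁅⁆∪⁅⁆≡⁅⁆∆⁅⁆ : ∀ {a b : Fin n} → a ≢ b → ⁅ a ⁆ ∪ ⁅ b ⁆ ≡ ⁅ a ⁆ ∆ ⁅ b ⁆
⁅⁆∪⁅⁆≡⁅⁆∆⁅⁆ {a = zero}  {zero}  a≢b = contradiction refl a≢b
⁅⁆∪⁅⁆≡⁅⁆∆⁅⁆ {a = zero}  {suc b} a≢b = cong (inside ∷_)
  (≡.trans (∪-identityˡ ⁅ b ⁆) (≡.trans (sym (∆-⊥ ⁅ b ⁆)) (∆-comm ⁅ b ⁆ ⊥)))
⁅⁆∪⁅⁆≡⁅⁆∆⁅⁆ {a = suc a} {zero}  a≢b = cong (inside ∷_)
  (≡.trans (∪-identityʳ ⁅ a ⁆) (sym (∆-⊥ ⁅ a ⁆)))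
⁅⁆∪⁅⁆≡⁅⁆∆⁅⁆ {a = suc a} {suc b} a≢b = cong (outside ∷_) (⁅⁆∪⁅⁆≡⁅⁆∆⁅⁆ (a≢b ∘ cong suc))

⊈⇒∃ : ∀ (S T : Subset n) → ¬ S ⊆ T → ∃ λ e → e ∈ S × e ∉ T
⊈⇒∃ S T S⊈T with Fin.any? (λ e → (e ∈? S) ×-dec ¬? (e ∈? T))
... | yes e∈S∖T = e∈S∖T
... | no  ∄e    = contradiction
  (λ {e} e∈S → decidable-stable (e ∈? T) λ e∉T → ∄e (e , e∈S , e∉T)) S⊈T

toSubset : {P : Pred (Fin n) ℓ} → Decidable P → Subset n
toSubset P? = tabulate (does ∘ P?)

module _ {P : Pred (Fin n) ℓ} (P? : Decidable P) where

  ∈-toSubset⁺ : ∀ {e} → P e → e ∈ toSubset P?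
  ∈-toSubset⁺ {e} Pe = Vec.lookup⇒[]= e _
    (≡.trans (Vec.lookup∘tabulate (does ∘ P?) e) (dec-true (P? e) Pe))

  ∈-toSubset⁻ : ∀ {e} → e ∈ toSubset P? → P e
  ∈-toSubset⁻ {e} e∈ = decidable-stable (P? e) λ ¬Pe → contradiction
    (≡.trans (sym (Vec.[]=⇒lookup e∈))
      (≡.trans (Vec.lookup∘tabulate (does ∘ P?) e) (dec-false (P? e) ¬Pe)))
    λ ()

-- Used for `allFin`, the tabulation of the identity; a general `f` lets the induction pass to
-- `f ∘ suc`.
length-filter-tabulate : ∀ {P : Pred A ℓ} (P? : Decidable P) (f : Fin n → A) S →
  (∀ i → P (f i) ⇔ i ∈ S) → length (filter P? (List.tabulate f)) ≡ ∣ S ∣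
length-filter-tabulate {n = zero}  P? f []            P⇔∈ = refl
length-filter-tabulate {n = suc n} P? f (s ∷ S) P⇔∈
  with IH ← length-filter-tabulate P? (f ∘ suc) S
              (λ i → mk⇔ (drop-there ∘ Equivalence.to (P⇔∈ (suc i))) (Equivalence.from (P⇔∈ (suc i)) ∘ there))
  with P? (f zero) | s
... | yes _ | inside  = cong suc IH
... | no  _ | outside = IH
... | yes p | outside = contradiction (Equivalence.to (P⇔∈ zero) p) λ ()
... | no ¬p | inside  = contradiction (Equivalence.from (P⇔∈ zero) here) ¬p

-- The distance to `A` and the termination measure of `fits-exists` are both weights of `A ∆ F`, for
-- `const 1` and for `rank`, so one set of estimates serves both.
weight : (Fin n → ℕ) → Subset n → ℕ
weight r []            = 0
weight r (inside  ∷ S) = r zero ℕ.+ weight (r ∘ suc) S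
weight r (outside ∷ S) = weight (r ∘ suc) S

∣S∣≡weight : ∀ (S : Subset n) → ∣ S ∣ ≡ weight (const 1) S
∣S∣≡weight []            = refl
∣S∣≡weight (inside  ∷ S) = cong suc (∣S∣≡weight S)
∣S∣≡weight (outside ∷ S) = ∣S∣≡weight S

weight-remove : ∀ (r : Fin n → ℕ) {e S} → e ∈ S → r e ℕ.+ weight r (S ∆ ⁅ e ⁆) ≡ weight r S
weight-remove r {S = inside ∷ S} here = cong (λ T → r zero ℕ.+ weight (r ∘ suc) T) (∆-⊥ S)
weight-remove r {suc e} {inside ∷ S} (there e∈S) = ≡.trans
  (x∙yz≈y∙xz (r (suc e)) (r zero) _) (cong (r zero ℕ.+_) (weight-remove (r ∘ suc) e∈S))
  where open CommutativeSemigroupProperties ℕ.+-commutativeSemigroup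
weight-remove r {S = outside ∷ S} (there e∈S) = weight-remove (r ∘ suc) e∈S

weight-toggle : ∀ (r : Fin n → ℕ) b S → weight r (S ∆ ⁅ b ⁆) ℕ.≤ r b ℕ.+ weight r S
weight-toggle r b S with b ∈? S
... | yes b∈S = begin
  weight r (S ∆ ⁅ b ⁆)                     ≤⟨ ℕ.m≤n+m _ (r b) ⟩
  r b ℕ.+ weight r (S ∆ ⁅ b ⁆)             ≡⟨ weight-remove r b∈S ⟩
  weight r S                               ≤⟨ ℕ.m≤n+m _ (r b) ⟩
  r b ℕ.+ weight r S                       ∎
  where open ℕ.≤-Reasoning
... | no b∉S = begin
  weight r (S ∆ ⁅ b ⁆)                     ≡⟨ weight-remove r b∈S∆⁅b⁆ ⟨
  r b ℕ.+ weight r (S ∆ ⁅ b ⁆ ∆ ⁅ b ⁆)     ≡⟨ cong (λ T → r b ℕ.+ weight r T) S∆⁅b⁆∆⁅b⁆≡S ⟩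
  r b ℕ.+ weight r S                       ∎
  where
  open ℕ.≤-Reasoning
  S∆⁅b⁆∆⁅b⁆≡S : S ∆ ⁅ b ⁆ ∆ ⁅ b ⁆ ≡ S
  S∆⁅b⁆∆⁅b⁆≡S = ≡.trans (∆-comm (S ∆ ⁅ b ⁆) ⁅ b ⁆)
    (≡.trans (cong (⁅ b ⁆ ∆_) (∆-comm S ⁅ b ⁆)) (∆-cancelˡ ⁅ b ⁆ S))
  -- `⁅ b ⁆` is the symmetric difference of `S` and `S ∆ ⁅ b ⁆`, so `b` lies in one of them.
  b∈S∆⁅b⁆ : b ∈ S ∆ ⁅ b ⁆
  b∈S∆⁅b⁆ with ∈-∆⁻ S (S ∆ ⁅ b ⁆) (subst (b ∈_) (sym (∆-cancelˡ S ⁅ b ⁆)) (x∈⁅x⁆ b))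
  ... | inj₁ b∈S = contradiction b∈S b∉S
  ... | inj₂ b∈  = b∈

-- Two successive toggles: `e` leaves and releases exactly `r e`, while `b` may enter or leave and
-- so costs at most `r b`.
weight-swap : ∀ (r : Fin n → ℕ) {e b S} → e ≢ b → e ∈ S →
  r e ℕ.+ weight r (S ∆ (⁅ e ⁆ ∪ ⁅ b ⁆)) ℕ.≤ r b ℕ.+ weight r S
weight-swap r {e} {b} {S} e≢b e∈S = begin
  r e ℕ.+ weight r (S ∆ (⁅ e ⁆ ∪ ⁅ b ⁆))    ≡⟨ cong (λ T → r e ℕ.+ weight r T) S∆⁅e,b⁆≡ ⟩
  r e ℕ.+ weight r (S ∆ ⁅ e ⁆ ∆ ⁅ b ⁆)      ≤⟨ ℕ.+-monoʳ-≤ (r e) (weight-toggle r b (S ∆ ⁅ e ⁆)) ⟩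
  r e ℕ.+ (r b ℕ.+ weight r (S ∆ ⁅ e ⁆))    ≡⟨ x∙yz≈y∙xz (r e) (r b) _ ⟩
  r b ℕ.+ (r e ℕ.+ weight r (S ∆ ⁅ e ⁆))    ≡⟨ cong (r b ℕ.+_) (weight-remove r e∈S) ⟩
  r b ℕ.+ weight r S                        ∎
  where
  open ℕ.≤-Reasoning
  S∆⁅e,b⁆≡ : S ∆ (⁅ e ⁆ ∪ ⁅ b ⁆) ≡ S ∆ ⁅ e ⁆ ∆ ⁅ b ⁆
  S∆⁅e,b⁆≡ = ≡.trans (cong (S ∆_) (⁅⁆∪⁅⁆≡⁅⁆∆⁅⁆ e≢b)) (sym (∆-assoc S ⁅ e ⁆ ⁅ b ⁆))
  open CommutativeSemigroupProperties ℕ.+-commutativeSemigroup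

-- Feasible sets nearest to A

r-min≡ : ∀ (D : DeltaMatroid ℓ n) {S} → Feasible D S →
         (∀ {G} → Feasible D G → ∣ S ∣ ℕ.≤ ∣ G ∣) → r-min D ≡ ∣ S ∣
r-min≡ {n = n} D {S} S∈D S-least = min≈v⁺
  (∈-map⁺ ∣_∣ (∈-filter⁺ (feasible? D) (∈-subsets S) S∈D))
  (All.tabulate λ k∈ → let (G , G∈ , k≡∣G∣) = ∈-map⁻ ∣_∣ k∈ in
    subst (∣ S ∣ ℕ.≤_) (sym k≡∣G∣) (S-least (proj₂ (∈-filter⁻ (feasible? D) {xs = subsets n} G∈))))
  -- The default `n` of `min` does not undercut the minimum.
  (∣p∣≤n S)

module _ (D : DeltaMatroid ℓ n) where

  twist-feasible⁻ : ∀ F {S} → Feasible (twist D F) S → Feasible D (F ∆ S)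
  twist-feasible⁻ F (G , G∈D , refl) = subst (Feasible D) (sym (∆-cancelˡ F G)) G∈D

  twist-feasible⁺ : ∀ F {S} → Feasible D (F ∆ S) → Feasible (twist D F) S
  twist-feasible⁺ F {S} F∆S∈D = F ∆ S , F∆S∈D , sym (∆-cancelˡ F S)

  module _ {_<_ : Rel (Fin n) ℓ′} (isSTO : IsStrictTotalOrder _≡_ _<_) where

    open IsStrictTotalOrder isSTO using (_<?_; compare; irrefl; isStrictPartialOrder)
      renaming (trans to <-trans)

    -- Exchange at active orientable points

    activeOrientable? : ∀ F → Decidable (λ a → Active D F isSTO a × Orientable D F a)
    activeOrientable? F a = active? D F isSTO a ×-dec orientable? D F a

    activeOrientable : Subset n → Subset n
    activeOrientable F = toSubset (activeOrientable? F)

    -- The `suc` makes every rank positive, so that removing a single point, even the least one,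
    -- lowers the weight strictly.
    rank : Fin n → ℕ
    rank e = suc ∣ toSubset (_<? e) ∣

    rank-mono : ∀ {b e} → b < e → rank b ℕ.< rank e
    rank-mono {b} {e} b<e = ℕ.s≤s (p⊂q⇒∣p∣<∣q∣
      ( (λ a∈ → ∈-toSubset⁺ (_<? e) (<-trans (∈-toSubset⁻ (_<? b) a∈) b<e))
      , b , ∈-toSubset⁺ (_<? e) b<e , irrefl refl ∘ ∈-toSubset⁻ (_<? b)))

    -- Exchange at `e` returns some `b`. If `b` were `e`, then `e` would be nonorientable. If `b`
    -- were below `e`, the two would be paired, and as `e` is orientable this means interlaced,
    -- against activity.
    exchange-up : ∀ {F G e} → Feasible D F → Feasible D G →
                  e ∈ F ∆ G → e ∈ activeOrientable F → ∃ λ b → e < b × b ∈ F ∆ G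
    exchange-up {F} {G} {e} F∈D G∈D e∈F∆G e∈T
      with b , b∈F∆G , F∆eb∈D ← exchange D F∈D G∈D e∈F∆G
         | active , orientable ← ∈-toSubset⁻ (activeOrientable? F) e∈T
      with compare e b
    ... | tri< e<b _ _ = b , e<b , b∈F∆G
    ... | tri≈ _ refl _ = contradiction
      (twist-feasible⁺ F (subst (λ S → Feasible D (F ∆ S)) (∪-idem ⁅ e ⁆) F∆eb∈D)) orientable
    ... | tri> _ e≢b b<e = contradiction
      (e≢b , inj₁ (orientable ∘ proj₁ , twist-feasible⁺ F F∆eb∈D)) (active b b<e)

    exchange-down : ∀ {F e} → e ∉ activeOrientable F →
                    Feasible D (F ∆ ⁅ e ⁆) ⊎ ∃ λ b → b < e × Feasible D (F ∆ (⁅ e ⁆ ∪ ⁅ b ⁆))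
    exchange-down {F} {e} e∉T with nonorientable? D F e
    ... | yes nonorientable = inj₁ (twist-feasible⁻ F nonorientable)
    ... | no  orientable
      with Fin.any? (λ b → (b <? e) ×-dec interlaced? D F e b)
    ...   | yes (b , b<e , _ , inj₁ (_ , paired)) = inj₂ (b , b<e , twist-feasible⁻ F paired)
    -- For an orientable `e` only the paired form of interlacement can occur.
    ...   | yes (b , b<e , _ , inj₂ (both , _))   = contradiction (proj₁ both) orientable
    ...   | no  ∄b = contradiction
      (∈-toSubset⁺ (activeOrientable? F) ((λ b b<e e~b → ∄b (b , b<e , e~b)) , orientable)) e∉T

    -- The sets `A` that fit `F` form an interval around `F` in the subset lattice: points of
    -- `activeOrientable F` are free, all others are as in `F`. The next two lemmas show that the
    -- intervals of the feasible sets partition all subsets.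
    Fits : Subset n → Subset n → Set
    Fits A F = A ∆ F ⊆ activeOrientable F

    -- Each element of `F ∆ G` would have a larger one above it, which is impossible in a finite
    -- order; hence the induction along the reversed order.
    fits-unique : ∀ {A F G} → Feasible D F → Feasible D G → Fits A F → Fits A G → F ≡ G
    fits-unique {A} {F} {G} F∈D G∈D A-F A-G =
      empty-∆⇒≡ F G λ e → absurd (spo-noetherian isStrictPartialOrder e)
      where
      absurd : ∀ {e} → Acc (flip _<_) e → e ∉ F ∆ G
      absurd {e} (acc rec) e∈F∆G
        with ∈-∆⁻ (A ∆ F) (A ∆ G) (subst (e ∈_) (sym (∆-cancel A F G)) e∈F∆G)
      ... | inj₁ e∈A∆F =
        let (b , e<b , b∈F∆G) = exchange-up F∈D G∈D e∈F∆G (A-F e∈A∆F)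
        in absurd (rec e<b) b∈F∆G
      -- The same ascent with `F` and `G` interchanged.
      ... | inj₂ e∈A∆G =
        let (b , e<b , b∈G∆F) = exchange-up G∈D F∈D (subst (e ∈_) (∆-comm F G) e∈F∆G) (A-G e∈A∆G)
        in absurd (rec e<b) (subst (b ∈_) (∆-comm G F) b∈G∆F)

    -- The distance bound is carried along the descent so that `fits-nearest` can start it from any
    -- feasible competitor.
    fits-exists : ∀ {A F} → Feasible D F →
                  ∃ λ G → Feasible D G × Fits A G × ∣ A ∆ G ∣ ℕ.≤ ∣ A ∆ F ∣
    fits-exists {A} F∈D = descend F∈D (ℕ.<-wellFounded _)
      where
      descend : ∀ {F} → Feasible D F → Acc ℕ._<_ (weight rank (A ∆ F)) →
                ∃ λ G → Feasible D G × Fits A G × ∣ A ∆ G ∣ ℕ.≤ ∣ A ∆ F ∣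
      descend {F} F∈D (acc rec) with (A ∆ F) ⊆? activeOrientable F
      ... | yes A-F = F , F∈D , A-F , ℕ.≤-refl
      ... | no ¬A-F
        with e , e∈A∆F , e∉T ← ⊈⇒∃ (A ∆ F) (activeOrientable F) ¬A-F
        with exchange-down e∉T
      ... | inj₁ F∆e∈D = Product.map₂ (Product.map₂ (Product.map₂ (flip ℕ.≤-trans nearer)))
        (descend F∆e∈D (rec lower))
        where
        remove : ∀ r → r e ℕ.+ weight r (A ∆ (F ∆ ⁅ e ⁆)) ≡ weight r (A ∆ F)
        remove r = ≡.trans (cong (λ S → r e ℕ.+ weight r S) (sym (∆-assoc A F ⁅ e ⁆))) (weight-remove r e∈A∆F)
        lower : weight rank (A ∆ (F ∆ ⁅ e ⁆)) ℕ.< weight rank (A ∆ F)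
        lower = subst (weight rank (A ∆ (F ∆ ⁅ e ⁆)) ℕ.<_) (remove rank) (ℕ.m<n+m _ ℕ.z<s)
        nearer : ∣ A ∆ (F ∆ ⁅ e ⁆) ∣ ℕ.≤ ∣ A ∆ F ∣
        nearer rewrite ∣S∣≡weight (A ∆ (F ∆ ⁅ e ⁆)) | ∣S∣≡weight (A ∆ F) =
          ℕ.≤-trans (ℕ.n≤1+n _) (ℕ.≤-reflexive (remove (const 1)))
      ... | inj₂ (b , b<e , F∆eb∈D) = Product.map₂ (Product.map₂ (Product.map₂ (flip ℕ.≤-trans nearer)))
        (descend F∆eb∈D (rec lower))
        where
        e≢b : e ≢ b
        e≢b e≡b = irrefl (sym e≡b) b<e
        exchanged : ∀ r → r e ℕ.+ weight r (A ∆ (F ∆ (⁅ e ⁆ ∪ ⁅ b ⁆))) ℕ.≤ r b ℕ.+ weight r (A ∆ F)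
        exchanged r = subst (λ S → r e ℕ.+ weight r S ℕ.≤ r b ℕ.+ weight r (A ∆ F))
          (∆-assoc A F _) (weight-swap r e≢b e∈A∆F)
        lower : weight rank (A ∆ (F ∆ (⁅ e ⁆ ∪ ⁅ b ⁆))) ℕ.< weight rank (A ∆ F)
        -- With w and w′ the old and new weights: rank b + w′ < rank e + w′ ≤ rank b + w.
        lower = ℕ.+-cancelˡ-< (rank b) _ _
          (ℕ.<-≤-trans (ℕ.+-monoˡ-< _ (rank-mono b<e)) (exchanged rank))
        nearer : ∣ A ∆ (F ∆ (⁅ e ⁆ ∪ ⁅ b ⁆)) ∣ ℕ.≤ ∣ A ∆ F ∣
        nearer rewrite ∣S∣≡weight (A ∆ (F ∆ (⁅ e ⁆ ∪ ⁅ b ⁆))) | ∣S∣≡weight (A ∆ F) =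
          -- For `const 1` both points weigh the same, so only a weak inequality remains; the strict
          -- descent comes from `rank`.
          ℕ.+-cancelˡ-≤ 1 _ _ (exchanged (const 1))

    -- The descent from any feasible `G` ends, by uniqueness, at `F`, and it never moves away from
    -- `A`.
    fits-nearest : ∀ {A F} → Feasible D F → Fits A F → r-min (twist D A) ≡ ∣ A ∆ F ∣
    fits-nearest {A} {F} F∈D A-F =
      r-min≡ (twist D A) (F , F∈D , refl) λ { (G , G∈D , refl) → nearest G∈D }
      where
      nearest : ∀ {G} → Feasible D G → ∣ A ∆ F ∣ ℕ.≤ ∣ A ∆ G ∣
      nearest {G} G∈D with F′ , F′∈D , A-F′ , ∣A∆F′∣≤∣A∆G∣ ← fits-exists {A} G∈D
        = subst (λ F → ∣ A ∆ F ∣ ℕ.≤ ∣ A ∆ G ∣) (fits-unique F′∈D F∈D A-F′ A-F) ∣A∆F′∣≤∣A∆G∣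

    -- Summation over feasible sets

    fits-term : Subset n → Subset n → Laurent
    fits-term A F = if does ((A ∆ F) ⊆? activeOrientable F) then distance-monomial F A else 0#

    -- Only the one feasible set that `A` fits contributes, and its distance to `A` is the exponent
    -- of `y`.
    ∑-fits : ∀ A → x ^ ∣ A ∣ * y ^ r-min (twist D A) ↭ ∑[ F ← feasibleSets D ] fits-term A F
    ∑-fits A with F , F∈D , A-F , _ ← fits-exists {A} (proj₂ (nonempty D)) = begin
      x ^ ∣ A ∣ * y ^ r-min (twist D A)
        ≡⟨ cong (λ k → x ^ ∣ A ∣ * y ^ k) (fits-nearest F∈D A-F) ⟩
      distance-monomial F A
        ≡⟨ at-F ⟨
      feasible-fits-term F
        ↭⟨ ∑-single feasible-fits-term F elsewhere ⟨
      ∑ (subsets n) feasible-fits-term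
        ≡⟨ ∑-filter (feasible? D) (subsets n) (fits-term A) ⟨
      ∑[ F ← feasibleSets D ] fits-term A F ∎
      where
      open PermutationReasoning
      -- Feasibility moves from the list into the summand, because `∑-single` runs over all subsets.
      feasible-fits-term : Subset n → Laurent
      feasible-fits-term G = if does (feasible? D G) then fits-term A G else 0#
      at-F : feasible-fits-term F ≡ distance-monomial F A
      at-F rewrite dec-true (feasible? D F) F∈D
                 | dec-true ((A ∆ F) ⊆? activeOrientable F) A-F = refl
      elsewhere : ∀ G → G ≢ F → feasible-fits-term G ≡ 0#
      elsewhere G G≢F with feasible? D G
      ... | no  _ = refl
      ... | yes G∈D
        rewrite dec-false ((A ∆ G) ⊆? activeOrientable G)
                  (λ A-G → G≢F (fits-unique G∈D F∈D A-G A-F)) = refl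

    internal≡ : ∀ F → internalActiveOrientable D F isSTO ≡ ∣ F ∩ activeOrientable F ∣
    internal≡ F = length-filter-tabulate _ _ (F ∩ activeOrientable F) λ a → mk⇔
      (λ (a∈F , a∈T) → x∈p∩q⁺ (a∈F , ∈-toSubset⁺ (activeOrientable? F) a∈T))
      (Product.map₂ (∈-toSubset⁻ (activeOrientable? F)) ∘ x∈p∩q⁻ F (activeOrientable F))

    external≡ : ∀ F → externalActiveOrientable D F isSTO ≡ ∣ ∁ F ∩ activeOrientable F ∣
    external≡ F = length-filter-tabulate _ _ (∁ F ∩ activeOrientable F) λ a → mk⇔
      (λ (a∉F , a∈T) → x∈p∩q⁺ (x∉p⇒x∈∁p a∉F , ∈-toSubset⁺ (activeOrientable? F) a∈T))
      (Product.map x∈∁p⇒x∉p (∈-toSubset⁻ (activeOrientable? F)) ∘ x∈p∩q⁻ (∁ F) (activeOrientable F))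

theorem5p2 : ∀ {ℓ ℓ′ : Level} {n : ℕ} (D : DeltaMatroid ℓ n)
    {_<_ : Rel (Fin n) ℓ′} (isSTO : IsStrictTotalOrder _≡_ _<_) →
    let i = λ F → internalActiveOrientable D F isSTO
        j = λ F → externalActiveOrientable D F isSTO
    in interlacePolynomial D
       ≈ ∑[ F ← feasibleSets D ]
           (x ^ ∣ F ∣ * (1# + y * x⁻¹) ^ i F * (1# + x * y) ^ j F)
theorem5p2 {n = n} D isSTO = ↭⇒≈ (begin
  interlacePolynomial D
    ↭⟨ ∑-cong (subsets n) (∑-fits D isSTO) ⟩
  ∑[ A ← subsets n ] ∑[ F ← feasibleSets D ] fits-term D isSTO A F
    -- Double counting of the pairs in which `A` fits `F`: by `A` they give the interlace
    -- polynomial, by `F` the interval sums.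
    ↭⟨ ∑-swap (subsets n) (feasibleSets D) (fits-term D isSTO) ⟩
  ∑[ F ← feasibleSets D ] ∑[ A ← subsets n ] fits-term D isSTO A F
    ↭⟨ ∑-cong (feasibleSets D) (λ F → ↭-trans
         (∑-interval F (activeOrientable D isSTO F))
         (↭-reflexive (sym (cong₂ (λ i j → x ^ ∣ F ∣ * (1# + y * x⁻¹) ^ i * (1# + x * y) ^ j)
           (internal≡ D isSTO F) (external≡ D isSTO F))))) ⟩
  _ ∎)
  where open PermutationReasoning
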